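{- For every integer $n\ge0$, $\beta\in\mathbb{C}$ and $0\le p\le n$, with $G_n^{\beta}=U_nE^{n\beta}U_n^{ -1}$, $$G_n^{\beta}x^p=\sum_{m=0}^{n}\binom{ -n\beta+p}{m}\binom{n\beta+n-p}{n-m}x^m .$$
   Context: Polynomials over $\mathbb{C}$; $\binom{y}{k}=y(y-1)\cdots(y-k+1)/k!$ for $k\ge0$. $U_n$ is the linear map on polynomials of degree at most $n$ with $U_nx^p=\frac{(1-x)^{n+1}}{n!}\sum_{m\ge0}m^px^m$ ($0^0=1$), inverse $U_n^{ -1}x^p=(x)_p[x+1]_{n-p}$, $(y)_p=y(y-1)\cdots(y-p+1)$, $[y]_k=y(y+1)\cdots(y+k-1)$. $E^{\gamma}c(x)=c(x+\gamma)$. -}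

module Defs where

open import Level using (Level)
open import Algebra.Bundles using (CommutativeRing)
open import Data.Nat as ℕ using (ℕ; zero; suc; _∸_)
open import Data.List using (List; []; _∷_; replicate; _++_; map; upTo)

-- Polynomials over a commutative ring R in which every positive integer is
-- invertible (a ℚ-algebra, e.g. ℂ).  `inv i` is the chosen inverse of i+1.
module Poly {c ℓ : Level} (R : CommutativeRing c ℓ)
            (inv : CommutativeRing.Carrier R → CommutativeRing.Carrier R) where
  open CommutativeRing R

  -- polynomials as coefficient lists, lowest degree first
  P : Set c
  P = List Carrier

  coeff : P → ℕ → Carrier
  coeff []      _       = 0#
  coeff (a ∷ p) zero    = a
  coeff (a ∷ p) (suc k) = coeff p k

  _⊕_ : P → P → P
  []      ⊕ q       = q
  (a ∷ p) ⊕ []      = a ∷ p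
  (a ∷ p) ⊕ (b ∷ q) = (a + b) ∷ (p ⊕ q)

  scale : Carrier → P → P
  scale a p = map (a *_) p

  _⊗_ : P → P → P
  []      ⊗ q = []
  (a ∷ p) ⊗ q = scale a q ⊕ (0# ∷ (p ⊗ q))

  const : Carrier → P
  const a = a ∷ []

  _∘ₚ_ : P → P → P
  []      ∘ₚ q = []
  (a ∷ p) ∘ₚ q = const a ⊕ (q ⊗ (p ∘ₚ q))

  monomial : ℕ → P
  monomial p = replicate p 0# ++ (1# ∷ [])

  natR : ℕ → Carrier
  natR zero    = 0#
  natR (suc m) = 1# + natR m

  -- a^k with a^0 = 1 (so 0^0 = 1)
  pow : Carrier → ℕ → Carrier
  pow a zero    = 1#
  pow a (suc k) = pow a k * a

  invFact : ℕ → Carrier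
  invFact zero    = 1#
  invFact (suc k) = invFact k * inv (natR (suc k))

  fallingR : Carrier → ℕ → Carrier
  fallingR y zero    = 1#
  fallingR y (suc k) = fallingR y k * (y + - natR k)

  binom : Carrier → ℕ → Carrier
  binom y k = fallingR y k * invFact k

  fallingP : ℕ → P
  fallingP zero    = const 1#
  fallingP (suc k) = fallingP k ⊗ ((- natR k) ∷ 1# ∷ [])

  risingP1 : ℕ → P
  risingP1 zero    = const 1#
  risingP1 (suc k) = risingP1 k ⊗ (natR (suc k) ∷ 1# ∷ [])

  linExtFrom : (ℕ → P) → ℕ → P → P
  linExtFrom f k []      = []
  linExtFrom f k (a ∷ c) = scale a (f k) ⊕ linExtFrom f (suc k) c

  linExt : (ℕ → P) → P → P
  linExt f = linExtFrom f 0

  E : Carrier → P → P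
  E γ c = c ∘ₚ (γ ∷ 1# ∷ [])

  UinvBasis : ℕ → ℕ → P
  UinvBasis n p = fallingP p ⊗ risingP1 (n ∸ p)

  Uinv : ℕ → P → P
  Uinv n = linExt (UinvBasis n)

  oneMinusXPow : ℕ → P
  oneMinusXPow zero    = const 1#
  oneMinusXPow (suc k) = oneMinusXPow k ⊗ (1# ∷ (- 1#) ∷ [])

  -- k-th coefficient of the formal power series (1-x)^{n+1} · Σ_{m≥0} m^p x^m
  -- (Cauchy product: Σ_{j=0}^{k} [x^{k-j}](1-x)^{n+1} · j^p)
  seriesCoeff : ℕ → ℕ → ℕ → Carrier
  seriesCoeff n p k = go k
    where
    go : ℕ → Carrier
    go zero    = coeff (oneMinusXPow (suc n)) k * pow (natR 0) p
    go (suc j) = coeff (oneMinusXPow (suc n)) (k ∸ suc j) * pow (natR (suc j)) p + go j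

  -- U_n x^p = (1-x)^{n+1}/n! Σ_{m≥0} m^p x^m, a polynomial of degree ≤ n;
  -- we list its coefficients of degrees 0..n
  UBasis : ℕ → ℕ → P
  UBasis n p = map (λ k → invFact n * seriesCoeff n p k) (upTo (suc n))

  U : ℕ → P → P
  U n = linExt (UBasis n)

  G : ℕ → Carrier → P → P
  G n β c = U n (E (natR n * β) (Uinv n c))

  rhs : ℕ → Carrier → ℕ → P
  rhs n β p = map (λ m → binom (- (natR n * β) + natR p) m
                       * binom (natR n * β + natR (n ∸ p)) (n ∸ m))
                  (upTo (suc n))

{-# OPTIONS --safe #-}

-- Evaluating at natural numbers turns Uₙ into the n+1-st backward difference:
-- the k-th coefficient of Uₙ c is ∇ⁿ⁺¹ (j ↦ c(j)) (k) / n!.  For c = E^γ Uₙ⁻¹ xᵖ,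
-- γ = nβ, the value c(j) is the falling factorial (y + j)ₙ with y = γ + n − p, so
-- it remains to show ∇ⁿ⁺¹ (j ↦ binom (y + j) n) (k) = binom (n − y) k * binom y (n − k).
-- Since binom (y + j) (n+1) = (y − n + j) / (n+1) * binom (y + j) n, and multiplication
-- by j commutes with ∇ up to a shift, both sides satisfy the same recurrence in n.

module Submission where

open import Defs
open import Level using (Level)
open import Algebra.Bundles using (CommutativeRing)
open import Algebra.Solver.Ring.AlmostCommutativeRing using (fromCommutativeRing; _-Raw-AlmostCommutative⟶_)
open import Data.Integer as ℤ using (ℤ; +_; -[1+_]; _⊖_)
open import Data.Integer.Properties as ℤₚ using ([1+m]⊖[1+n]≡m⊖n)
open import Data.List using ([]; _∷_; map; applyUpTo)
open import Data.Maybe as Maybe using (Maybe)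
open import Data.Nat as ℕ using (ℕ; zero; suc; _≤_; _<_; _∸_; z≤n; s≤s)
open import Data.Nat.Properties as ℕₚ using (n∸n≡0; +-∸-assoc; m+[n∸m]≡n; _≤?_; ≰⇒>; ≤-refl; m≤n⇒m≤1+n)
open import Function using (id; _∘_)
open import Relation.Binary.Consequences using (dec⇒weaklyDec)
open import Relation.Binary.PropositionalEquality as ≡ using (_≡_)
open import Relation.Nullary using (yes; no)

-- Ring solver with integer coefficients.

module IntegerCoefficients {c ℓ : Level} (R : CommutativeRing c ℓ) where
  open CommutativeRing R
  open import Algebra.Properties.Ring ring
  open import Algebra.Properties.AbelianGroup +-abelianGroup using (⁻¹-∙-comm)
  open import Algebra.Properties.CommutativeSemigroup +-commutativeSemigroup using (interchange)
  open import Algebra.Properties.Semiring.Mult.TCOptimised semiring using (_×_; 1+×; ×-homo-+; ×1-homo-*)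
  open import Relation.Binary.Reasoning.Setoid setoid

  -- Equality in R need not be decidable, so the solver normalises over ℤ. With the optimised `_×_`,
  -- `con (+ 0)` and `con (+ 1)` denote `0#` and `1#` definitionally, so solved equations match
  -- goals as written.
  fromℤ : ℤ → Carrier
  fromℤ (+ n)    = n × 1#
  fromℤ -[1+ n ] = - (suc n × 1#)

  fromℤ-⊖ : ∀ m n → fromℤ (m ⊖ n) ≈ m × 1# - n × 1#
  fromℤ-⊖ m       zero    = sym (trans (+-congˡ -0#≈0#) (+-identityʳ _))
  fromℤ-⊖ zero    (suc n) = sym (+-identityˡ _)
  fromℤ-⊖ (suc m) (suc n) = begin
    fromℤ (suc m ⊖ suc n)                       ≡⟨ ≡.cong fromℤ ([1+m]⊖[1+n]≡m⊖n m n) ⟩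
    fromℤ (m ⊖ n)                               ≈⟨ fromℤ-⊖ m n ⟩
    m × 1# - n × 1#                             ≈⟨ +-identityˡ _ ⟨
    0# + (m × 1# - n × 1#)                      ≈⟨ +-congʳ (-‿inverseʳ 1#) ⟨
    (1# - 1#) + (m × 1# - n × 1#)               ≈⟨ interchange _ _ _ _ ⟩
    (1# + m × 1#) + (- 1# - n × 1#)             ≈⟨ +-congˡ (⁻¹-∙-comm _ _) ⟩
    (1# + m × 1#) - (1# + n × 1#)               ≈⟨ +-cong (1+× m 1#) (-‿cong (1+× n 1#)) ⟨
    suc m × 1# - suc n × 1#                     ∎

  fromℤ-neg : ∀ i → fromℤ (ℤ.- i) ≈ - fromℤ i
  fromℤ-neg (+ zero)  = sym -0#≈0#
  fromℤ-neg (+ suc n) = refl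
  fromℤ-neg -[1+ n ]  = sym (-‿involutive _)

  fromℤ-+ : ∀ i j → fromℤ (i ℤ.+ j) ≈ fromℤ i + fromℤ j
  fromℤ-+ (+ m)    (+ n)    = ×-homo-+ 1# m n
  fromℤ-+ (+ m)    -[1+ n ] = fromℤ-⊖ m (suc n)
  fromℤ-+ -[1+ m ] (+ n)    = trans (fromℤ-⊖ n (suc m)) (+-comm _ _)
  fromℤ-+ -[1+ m ] -[1+ n ] = begin
    - (suc (suc (m ℕ.+ n)) × 1#)    ≡⟨ ≡.cong (λ k → - (suc k × 1#)) (ℕₚ.+-suc m n) ⟨
    - ((suc m ℕ.+ suc n) × 1#)      ≈⟨ -‿cong (×-homo-+ 1# (suc m) (suc n)) ⟩
    - (suc m × 1# + suc n × 1#)     ≈⟨ ⁻¹-∙-comm _ _ ⟨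
    - (suc m × 1#) - suc n × 1#     ∎

  fromℤ-*-pos : ∀ m j → fromℤ (+ m ℤ.* j) ≈ m × 1# * fromℤ j
  fromℤ-*-pos m (+ n) = begin
    fromℤ (+ m ℤ.* + n)   ≡⟨ ≡.cong fromℤ (ℤₚ.pos-* m n) ⟨
    (m ℕ.* n) × 1#        ≈⟨ ×1-homo-* m n ⟩
    m × 1# * n × 1#       ∎
  fromℤ-*-pos m -[1+ n ] = begin
    fromℤ (+ m ℤ.* -[1+ n ])          ≡⟨ ≡.cong fromℤ (ℤₚ.neg-distribʳ-* (+ m) (+ suc n)) ⟨
    fromℤ (ℤ.- (+ m ℤ.* + suc n))     ≈⟨ fromℤ-neg (+ m ℤ.* + suc n) ⟩
    - fromℤ (+ m ℤ.* + suc n)         ≈⟨ -‿cong (fromℤ-*-pos m (+ suc n)) ⟩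
    - (m × 1# * suc n × 1#)           ≈⟨ -‿distribʳ-* _ _ ⟩
    m × 1# * - (suc n × 1#)           ∎

  fromℤ-* : ∀ i j → fromℤ (i ℤ.* j) ≈ fromℤ i * fromℤ j
  fromℤ-* (+ m)    j = fromℤ-*-pos m j
  fromℤ-* -[1+ m ] j = begin
    fromℤ (-[1+ m ] ℤ.* j)            ≡⟨ ≡.cong fromℤ (ℤₚ.neg-distribˡ-* (+ suc m) j) ⟨
    fromℤ (ℤ.- (+ suc m ℤ.* j))       ≈⟨ fromℤ-neg (+ suc m ℤ.* j) ⟩
    - fromℤ (+ suc m ℤ.* j)           ≈⟨ -‿cong (fromℤ-*-pos (suc m) j) ⟩
    - (suc m × 1# * fromℤ j)          ≈⟨ -‿distribˡ-* _ _ ⟩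
    - (suc m × 1#) * fromℤ j          ∎

  fromℤ-homo : ℤ.+-*-rawRing -Raw-AlmostCommutative⟶ fromCommutativeRing R
  fromℤ-homo = record
    { ⟦_⟧    = fromℤ
    ; +-homo = fromℤ-+
    ; *-homo = fromℤ-*
    ; -‿homo = fromℤ-neg
    ; 0-homo = refl
    ; 1-homo = refl
    }

  fromℤ≟ : ∀ i j → Maybe (fromℤ i ≈ fromℤ j)
  fromℤ≟ i j = Maybe.map (λ i≡j → reflexive (≡.cong fromℤ i≡j)) (dec⇒weaklyDec ℤ._≟_ i j)

  open import Algebra.Solver.Ring ℤ.+-*-rawRing (fromCommutativeRing R) fromℤ-homo fromℤ≟ public

module Differences {c ℓ : Level} (R : CommutativeRing c ℓ)
                   (inv : CommutativeRing.Carrier R → CommutativeRing.Carrier R) where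
  open CommutativeRing R
  open Poly R inv
  open IntegerCoefficients R using (solve; _:=_; _:+_; _:*_; _:-_; :-_; con)
  open import Relation.Binary.Reasoning.Setoid setoid

  -- Backward differences.

  shift : (ℕ → Carrier) → ℕ → Carrier
  shift f zero    = 0#
  shift f (suc k) = f k

  -- Sequences are extended by 0 to negative indices, so `shift` multiplies the generating series by
  -- x and `∇` multiplies it by 1 - x.
  ∇ : (ℕ → Carrier) → ℕ → Carrier
  ∇ f k = f k - shift f k

  ∇^ : ℕ → (ℕ → Carrier) → ℕ → Carrier
  ∇^ zero    f = f
  ∇^ (suc m) f = ∇ (∇^ m f)

  ∇-cong : ∀ {f g} → (∀ j → f j ≈ g j) → ∀ k → ∇ f k ≈ ∇ g k
  ∇-cong f≈g zero    = +-congʳ (f≈g 0)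
  ∇-cong f≈g (suc k) = +-cong (f≈g (suc k)) (-‿cong (f≈g k))

  ∇^-cong : ∀ m {f g} → (∀ j → f j ≈ g j) → ∀ k → ∇^ m f k ≈ ∇^ m g k
  ∇^-cong zero    f≈g = f≈g
  ∇^-cong (suc m) f≈g = ∇-cong (∇^-cong m f≈g)

  ∇-linear : ∀ a f g k → ∇ (λ j → a * f j + g j) k ≈ a * ∇ f k + ∇ g k
  ∇-linear a f g zero    = solve 3 (λ a x y → a :* x :+ y :- con (+ 0) := a :* (x :- con (+ 0)) :+ (y :- con (+ 0)))
                             refl a (f 0) (g 0)
  ∇-linear a f g (suc k) = solve 5 (λ a x y z w → a :* x :+ y :- (a :* z :+ w) := a :* (x :- z) :+ (y :- w))
                             refl a (f (suc k)) (g (suc k)) (f k) (g k)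

  ∇^-linear : ∀ m a f g k → ∇^ m (λ j → a * f j + g j) k ≈ a * ∇^ m f k + ∇^ m g k
  ∇^-linear zero    a f g k = refl
  ∇^-linear (suc m) a f g k = trans (∇-cong (∇^-linear m a f g) k) (∇-linear a (∇^ m f) (∇^ m g) k)

  -- Leibniz rule: multiplication by j acts on the generating series F as θ = x d/dx, and
  -- (1-x)^(m+1) θF = θ((1-x)^(m+1) F) + (m+1) x (1-x)^m F.
  ∇^-natR-* : ∀ m f k →
    ∇^ (suc m) (λ j → natR j * f j) k ≈ natR k * ∇^ (suc m) f k + natR (suc m) * shift (∇^ m f) k
  ∇^-natR-* zero f zero =
    solve 1 (λ x → con (+ 0) :* x :- con (+ 0)
                := con (+ 0) :* (x :- con (+ 0)) :+ (con (+ 1) :+ con (+ 0)) :* con (+ 0)) refl (f 0)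
  ∇^-natR-* zero f (suc k) =
    solve 3 (λ k x y → (con (+ 1) :+ k) :* x :- k :* y
                := (con (+ 1) :+ k) :* (x :- y) :+ (con (+ 1) :+ con (+ 0)) :* y) refl (natR k) (f (suc k)) (f k)
  ∇^-natR-* (suc m) f zero = trans (∇-cong (∇^-natR-* m f) 0)
    (solve 2 (λ x c → con (+ 0) :* x :+ c :* con (+ 0) :- con (+ 0)
                := con (+ 0) :* (x :- con (+ 0)) :+ (con (+ 1) :+ c) :* con (+ 0))
             refl (∇^ (suc m) f 0) (natR (suc m)))
  ∇^-natR-* (suc m) f (suc k) = trans (∇-cong (∇^-natR-* m f) (suc k))
    -- With w = y - z, the unequal multipliers give (1+k)x - kw = (1+k)(x - w) + w; the leftover w
    -- raises the constant from c to 1 + c.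
    (solve 5 (λ k c x y z → (con (+ 1) :+ k) :* x :+ c :* y :- (k :* (y :- z) :+ c :* z)
                := (con (+ 1) :+ k) :* (x :- (y :- z)) :+ (con (+ 1) :+ c) :* (y :- z))
             refl (natR k) (natR (suc m)) (∇^ (suc m) f (suc k)) (∇^ m f k) (shift (∇^ m f) k))

  -- Finite sums and Cauchy products.

  sumTo : (ℕ → Carrier) → ℕ → Carrier
  sumTo f zero    = f 0
  sumTo f (suc j) = f (suc j) + sumTo f j

  sumTo-cong : ∀ {f g} k → (∀ j → j ≤ k → f j ≈ g j) → sumTo f k ≈ sumTo g k
  sumTo-cong zero    f≈g = f≈g 0 z≤n
  sumTo-cong (suc k) f≈g = +-cong (f≈g (suc k) ≤-refl) (sumTo-cong k (λ j j≤k → f≈g j (m≤n⇒m≤1+n j≤k)))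

  sumTo-linear : ∀ a f g k → sumTo (λ j → a * f j + g j) k ≈ a * sumTo f k + sumTo g k
  sumTo-linear a f g zero    = refl
  sumTo-linear a f g (suc k) = trans (+-congˡ (sumTo-linear a f g k))
    (solve 5 (λ a x y z w → (a :* x :+ y) :+ (a :* z :+ w) := a :* (x :+ z) :+ (y :+ w))
             refl a (f (suc k)) (g (suc k)) (sumTo f k) (sumTo g k))

  -- This is the Cauchy product of the two generating series; `sumTo` adds the last term first, as
  -- the local `go` of `seriesCoeff` does.
  conv : (ℕ → Carrier) → (ℕ → Carrier) → ℕ → Carrier
  conv w g k = sumTo (λ j → w (k ∸ j) * g j) k

  conv-congˡ : ∀ {v w} g k → (∀ i → v i ≈ w i) → conv v g k ≈ conv w g k
  conv-congˡ g k v≈w = sumTo-cong k (λ j _ → *-congʳ (v≈w (k ∸ j)))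

  conv-congʳ : ∀ w {g h} k → (∀ j → g j ≈ h j) → conv w g k ≈ conv w h k
  conv-congʳ w k g≈h = sumTo-cong k (λ j _ → *-congˡ (g≈h j))

  conv-linearˡ : ∀ a v w g k → conv (λ i → a * v i + w i) g k ≈ a * conv v g k + conv w g k
  conv-linearˡ a v w g k = trans
    (sumTo-cong k λ j _ → solve 4 (λ a x y z → (a :* x :+ y) :* z := a :* (x :* z) :+ y :* z)
                                  refl a (v (k ∸ j)) (w (k ∸ j)) (g j))
    (sumTo-linear a (λ j → v (k ∸ j) * g j) (λ j → w (k ∸ j) * g j) k)

  conv-linearʳ : ∀ a w g h k → conv w (λ j → a * g j + h j) k ≈ a * conv w g k + conv w h k
  conv-linearʳ a w g h k = trans
    (sumTo-cong k λ j _ → solve 4 (λ a x y z → z :* (a :* x :+ y) := a :* (z :* x) :+ z :* y)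
                                  refl a (g j) (h j) (w (k ∸ j)))
    (sumTo-linear a (λ j → w (k ∸ j) * g j) (λ j → w (k ∸ j) * h j) k)

  -- The term j = k + 1 meets `w` at index 0. In the others `suc` passes through truncated
  -- subtraction because j ≤ k, which is why `sumTo-cong` hands that bound to its hypothesis.
  conv-suc : ∀ w g k → conv w g (suc k) ≈ w 0 * g (suc k) + conv (w ∘ suc) g k
  conv-suc w g k = +-cong
    (*-congʳ (reflexive (≡.cong w (n∸n≡0 k))))
    (sumTo-cong k λ j j≤k → *-congʳ (reflexive (≡.cong w (+-∸-assoc 1 j≤k))))

  conv-zeroˡ : ∀ w g k → (∀ i → w i ≈ 0#) → conv w g k ≈ 0#
  conv-zeroˡ w g zero    w≈0 = trans (*-congʳ (w≈0 0)) (zeroˡ _)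
  conv-zeroˡ w g (suc k) w≈0 = trans (conv-suc w g k)
    (trans (+-cong (trans (*-congʳ (w≈0 0)) (zeroˡ _)) (conv-zeroˡ (w ∘ suc) g k (w≈0 ∘ suc))) (+-identityˡ 0#))

  -- Associativity of the Cauchy product with the factor 1 - x: splitting off index 0 leaves a
  -- difference of two weights, to which linearity with scalar -1 applies.
  conv-∇ : ∀ w g k → conv (∇ w) g k ≈ ∇ (conv w g) k
  conv-∇ w g zero    = solve 2 (λ x y → (x :- con (+ 0)) :* y := x :* y :- con (+ 0)) refl (w 0) (g 0)
  conv-∇ w g (suc k) = begin
    conv (∇ w) g (suc k)
      ≈⟨ conv-suc (∇ w) g k ⟩
    (w 0 - 0#) * g (suc k) + conv (λ i → w (suc i) - w i) g k
      ≈⟨ +-congˡ (conv-congˡ g k λ i →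
           solve 2 (λ x y → x :- y := :- con (+ 1) :* y :+ x) refl (w (suc i)) (w i)) ⟩
    (w 0 - 0#) * g (suc k) + conv (λ i → - 1# * w i + w (suc i)) g k
      ≈⟨ +-congˡ (conv-linearˡ (- 1#) w (w ∘ suc) g k) ⟩
    (w 0 - 0#) * g (suc k) + (- 1# * conv w g k + conv (w ∘ suc) g k)
      ≈⟨ solve 4 (λ x y z u → (x :- con (+ 0)) :* y :+ (:- con (+ 1) :* z :+ u) := (x :* y :+ u) :- z)
               refl (w 0) (g (suc k)) (conv w g k) (conv (w ∘ suc) g k) ⟩
    (w 0 * g (suc k) + conv (w ∘ suc) g k) - conv w g k
      ≈⟨ +-congʳ (conv-suc w g k) ⟨
    conv w g (suc k) - conv w g k ∎

  -- Powers of 1 - x as iterated differences.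

  coeff-⊕ : ∀ q r k → coeff (q ⊕ r) k ≈ coeff q k + coeff r k
  coeff-⊕ []      r       k       = sym (+-identityˡ _)
  coeff-⊕ (a ∷ q) []      k       = sym (+-identityʳ _)
  coeff-⊕ (a ∷ q) (b ∷ r) zero    = refl
  coeff-⊕ (a ∷ q) (b ∷ r) (suc k) = coeff-⊕ q r k

  coeff-scale : ∀ a q k → coeff (scale a q) k ≈ a * coeff q k
  coeff-scale a []      k       = sym (zeroʳ a)
  coeff-scale a (b ∷ q) zero    = refl
  coeff-scale a (b ∷ q) (suc k) = coeff-scale a q k

  coeff-⊗-1-x : ∀ q k → coeff (q ⊗ (1# ∷ (- 1#) ∷ [])) k ≈ ∇ (coeff q) k
  coeff-⊗-1-x []      zero    = sym (-‿inverseʳ 0#)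
  coeff-⊗-1-x []      (suc k) = sym (-‿inverseʳ 0#)
  coeff-⊗-1-x (a ∷ q) zero    = solve 1 (λ a → a :* con (+ 1) :+ con (+ 0) := a :- con (+ 0)) refl a
  coeff-⊗-1-x (a ∷ q) (suc k) = begin
    coeff ((a * - 1# ∷ []) ⊕ (q ⊗ (1# ∷ (- 1#) ∷ []))) k
      ≈⟨ coeff-⊕ (a * - 1# ∷ []) (q ⊗ (1# ∷ (- 1#) ∷ [])) k ⟩
    coeff (a * - 1# ∷ []) k + coeff (q ⊗ (1# ∷ (- 1#) ∷ [])) k
      ≈⟨ +-congˡ (coeff-⊗-1-x q k) ⟩
    coeff (a * - 1# ∷ []) k + ∇ (coeff q) k
      ≈⟨ ∇-lower k ⟩
    coeff q k - coeff (a ∷ q) k ∎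
    where
    -- The constant `a * - 1#` is seen only at index 0, where `shift (coeff q)` is 0 and
    -- `coeff (a ∷ q)` is `a`; beyond index 0 these two sequences agree.
    ∇-lower : ∀ k → coeff (a * - 1# ∷ []) k + ∇ (coeff q) k ≈ coeff q k - coeff (a ∷ q) k
    ∇-lower zero    = solve 2 (λ a x → a :* :- con (+ 1) :+ (x :- con (+ 0)) := x :- a) refl a (coeff q 0)
    ∇-lower (suc k) = +-identityˡ _

  -- By `conv-∇`, each factor 1 - x of the weight moves out of the Cauchy product as one difference,
  -- until the weight is the unit series 1.
  conv-oneMinusXPow : ∀ m g k → conv (coeff (oneMinusXPow m)) g k ≈ ∇^ m g k
  conv-oneMinusXPow zero    g zero    = *-identityˡ _
  conv-oneMinusXPow zero    g (suc k) = trans (conv-suc (coeff (const 1#)) g k)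
    (trans (+-cong (*-identityˡ _) (conv-zeroˡ (λ _ → 0#) g k (λ _ → refl))) (+-identityʳ _))
  conv-oneMinusXPow (suc m) g k = begin
    conv (coeff (oneMinusXPow (suc m))) g k     ≈⟨ conv-congˡ g k (coeff-⊗-1-x (oneMinusXPow m)) ⟩
    conv (∇ (coeff (oneMinusXPow m))) g k       ≈⟨ conv-∇ (coeff (oneMinusXPow m)) g k ⟩
    ∇ (conv (coeff (oneMinusXPow m)) g) k       ≈⟨ ∇-cong (conv-oneMinusXPow m g) k ⟩
    ∇ (∇^ m g) k                                ∎

  module _ (n p : ℕ) where
    private
      term : ℕ → ℕ → Carrier
      term k j = coeff (oneMinusXPow (suc n)) (k ∸ j) * pow (natR j) p

    mutual
      -- The left-hand side is the local `go` of `seriesCoeff`, which has no name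
      -- outside; it is inferred from the use below, where abstracting `suc k`
      -- separates the two roles of k.
      seriesCoeff-go : ∀ k j → _ ≈ sumTo (term k) j

      seriesCoeff≈conv : ∀ k → seriesCoeff n p k ≈ conv (coeff (oneMinusXPow (suc n))) (λ j → pow (natR j) p) k
      seriesCoeff≈conv zero = refl
      seriesCoeff≈conv (suc k) with suc k
      ... | k′ = +-congˡ (seriesCoeff-go k′ k)

      seriesCoeff-go k zero    = refl
      seriesCoeff-go k (suc j) = +-congˡ (seriesCoeff-go k j)

  -- Evaluation of polynomials.

  eval : P → Carrier → Carrier
  eval []      x = 0#
  eval (a ∷ q) x = a + x * eval q x

  eval-cong : ∀ q {x y} → x ≈ y → eval q x ≈ eval q y
  eval-cong []      x≈y = refl
  eval-cong (a ∷ q) x≈y = +-congˡ (*-cong x≈y (eval-cong q x≈y))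

  eval-⊕ : ∀ q r x → eval (q ⊕ r) x ≈ eval q x + eval r x
  eval-⊕ []      r       x = sym (+-identityˡ _)
  eval-⊕ (a ∷ q) []      x = sym (+-identityʳ _)
  eval-⊕ (a ∷ q) (b ∷ r) x = trans (+-congˡ (*-congˡ (eval-⊕ q r x)))
    (solve 5 (λ a b x y z → (a :+ b) :+ x :* (y :+ z) := (a :+ x :* y) :+ (b :+ x :* z))
             refl a b x (eval q x) (eval r x))

  eval-scale : ∀ a q x → eval (scale a q) x ≈ a * eval q x
  eval-scale a []      x = sym (zeroʳ a)
  eval-scale a (b ∷ q) x = trans (+-congˡ (*-congˡ (eval-scale a q x)))
    (solve 4 (λ a b x y → a :* b :+ x :* (a :* y) := a :* (b :+ x :* y)) refl a b x (eval q x))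

  eval-⊗ : ∀ q r x → eval (q ⊗ r) x ≈ eval q x * eval r x
  eval-⊗ []      r x = sym (zeroˡ _)
  eval-⊗ (a ∷ q) r x = begin
    eval (scale a r ⊕ (0# ∷ (q ⊗ r))) x
      ≈⟨ eval-⊕ (scale a r) (0# ∷ (q ⊗ r)) x ⟩
    eval (scale a r) x + (0# + x * eval (q ⊗ r) x)
      ≈⟨ +-cong (eval-scale a r x) (+-congˡ (*-congˡ (eval-⊗ q r x))) ⟩
    a * eval r x + (0# + x * (eval q x * eval r x))
      ≈⟨ solve 4 (λ a x y z → a :* z :+ (con (+ 0) :+ x :* (y :* z)) := (a :+ x :* y) :* z)
               refl a x (eval q x) (eval r x) ⟩
    (a + x * eval q x) * eval r x ∎

  eval-∘ₚ : ∀ q r x → eval (q ∘ₚ r) x ≈ eval q (eval r x)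
  eval-∘ₚ []      r x = refl
  eval-∘ₚ (a ∷ q) r x = begin
    eval (const a ⊕ (r ⊗ (q ∘ₚ r))) x
      ≈⟨ eval-⊕ (const a) (r ⊗ (q ∘ₚ r)) x ⟩
    (a + x * 0#) + eval (r ⊗ (q ∘ₚ r)) x
      ≈⟨ +-cong (trans (+-congˡ (zeroʳ x)) (+-identityʳ a))
                (trans (eval-⊗ r (q ∘ₚ r) x) (*-congˡ (eval-∘ₚ q r x))) ⟩
    a + eval r x * eval q (eval r x) ∎

  eval-E : ∀ γ q x → eval (E γ q) x ≈ eval q (x + γ)
  eval-E γ q x = trans (eval-∘ₚ q (γ ∷ 1# ∷ []) x)
    (eval-cong q (solve 2 (λ g x → g :+ x :* (con (+ 1) :+ x :* con (+ 0)) := x :+ g) refl γ x))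

  -- The starting index stays general because each leading 0 of the monomial raises it by one.
  -- Values are compared instead of lists, since the zero multiples of the skipped polynomials may
  -- lengthen the list.
  eval-linExtFrom-monomial : ∀ f m p x → eval (linExtFrom f m (monomial p)) x ≈ eval (f (m ℕ.+ p)) x
  eval-linExtFrom-monomial f m zero x = begin
    eval (scale 1# (f m) ⊕ []) x       ≈⟨ eval-⊕ (scale 1# (f m)) [] x ⟩
    eval (scale 1# (f m)) x + 0#       ≈⟨ +-identityʳ _ ⟩
    eval (scale 1# (f m)) x            ≈⟨ eval-scale 1# (f m) x ⟩
    1# * eval (f m) x                  ≈⟨ *-identityˡ _ ⟩
    eval (f m) x                       ≡⟨ ≡.cong (λ i → eval (f i) x) (ℕₚ.+-identityʳ m) ⟨
    eval (f (m ℕ.+ 0)) x               ∎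
  eval-linExtFrom-monomial f m (suc p) x = begin
    eval (scale 0# (f m) ⊕ linExtFrom f (suc m) (monomial p)) x
      ≈⟨ eval-⊕ (scale 0# (f m)) (linExtFrom f (suc m) (monomial p)) x ⟩
    eval (scale 0# (f m)) x + eval (linExtFrom f (suc m) (monomial p)) x
      ≈⟨ +-cong (trans (eval-scale 0# (f m) x) (zeroˡ _)) (eval-linExtFrom-monomial f (suc m) p x) ⟩
    0# + eval (f (suc m ℕ.+ p)) x
      ≈⟨ +-identityˡ _ ⟩
    eval (f (suc m ℕ.+ p)) x
      ≡⟨ ≡.cong (λ i → eval (f i) x) (ℕₚ.+-suc m p) ⟨
    eval (f (m ℕ.+ suc p)) x ∎

  -- Falling factorials and the values of `Uinv`.

  natR-+ : ∀ m n → natR (m ℕ.+ n) ≈ natR m + natR n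
  natR-+ zero    n = sym (+-identityˡ _)
  natR-+ (suc m) n = trans (+-congˡ (natR-+ m n)) (sym (+-assoc _ _ _))

  fallingR-cong : ∀ {x y} k → x ≈ y → fallingR x k ≈ fallingR y k
  fallingR-cong zero    x≈y = refl
  fallingR-cong (suc k) x≈y = *-cong (fallingR-cong k x≈y) (+-congʳ x≈y)

  -- The definition adjoins factors at the end; this splits one off at the front. In the induction
  -- the end factors agree, since (1 + x) - (1 + k) = x - k.
  fallingR-shift : ∀ x k → fallingR (1# + x) (suc k) ≈ (1# + x) * fallingR x k
  fallingR-shift x zero    = solve 1 (λ x → con (+ 1) :* ((con (+ 1) :+ x) :- con (+ 0)) := (con (+ 1) :+ x) :* con (+ 1)) refl x
  fallingR-shift x (suc k) = trans (*-congʳ (fallingR-shift x k))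
    (solve 3 (λ x f k → ((con (+ 1) :+ x) :* f) :* ((con (+ 1) :+ x) :- (con (+ 1) :+ k)) := (con (+ 1) :+ x) :* (f :* (x :- k)))
             refl x (fallingR x k) (natR k))

  eval-fallingP : ∀ k x → eval (fallingP k) x ≈ fallingR x k
  eval-fallingP zero    x = trans (+-congˡ (zeroʳ x)) (+-identityʳ 1#)
  eval-fallingP (suc k) x = trans (eval-⊗ (fallingP k) (- natR k ∷ 1# ∷ []) x)
    (*-cong (eval-fallingP k x)
            (solve 2 (λ x k → :- k :+ x :* (con (+ 1) :+ x :* con (+ 0)) := x :- k) refl x (natR k)))

  -- The factors are the consecutive x - p + 1, ..., x + q, so they form one falling factorial
  -- starting at x + q. Each increase of q adds a factor at the front, whence `fallingR-shift`.
  eval-fallingP⊗risingP1 : ∀ p q x → eval (fallingP p ⊗ risingP1 q) x ≈ fallingR (x + natR q) (p ℕ.+ q)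
  eval-fallingP⊗risingP1 p q x = trans (eval-⊗ (fallingP p) (risingP1 q) x) (product q)
    where
    product : ∀ q → eval (fallingP p) x * eval (risingP1 q) x ≈ fallingR (x + natR q) (p ℕ.+ q)
    product zero = begin
      eval (fallingP p) x * (1# + x * 0#)     ≈⟨ solve 2 (λ f x → f :* (con (+ 1) :+ x :* con (+ 0)) := f) refl _ x ⟩
      eval (fallingP p) x                     ≈⟨ eval-fallingP p x ⟩
      fallingR x p                            ≈⟨ fallingR-cong p (+-identityʳ x) ⟨
      fallingR (x + 0#) p                     ≡⟨ ≡.cong (fallingR (x + 0#)) (ℕₚ.+-identityʳ p) ⟨
      fallingR (x + 0#) (p ℕ.+ 0)             ∎
    product (suc q) = begin
      eval (fallingP p) x * eval (risingP1 (suc q)) x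
        ≈⟨ *-congˡ (eval-⊗ (risingP1 q) (natR (suc q) ∷ 1# ∷ []) x) ⟩
      eval (fallingP p) x * (eval (risingP1 q) x * (natR (suc q) + x * (1# + x * 0#)))
        ≈⟨ solve 4 (λ f r x q → f :* (r :* ((con (+ 1) :+ q) :+ x :* (con (+ 1) :+ x :* con (+ 0))))
                       := (con (+ 1) :+ (x :+ q)) :* (f :* r)) refl _ _ x (natR q) ⟩
      (1# + (x + natR q)) * (eval (fallingP p) x * eval (risingP1 q) x)
        ≈⟨ *-congˡ (product q) ⟩
      (1# + (x + natR q)) * fallingR (x + natR q) (p ℕ.+ q)
        ≈⟨ fallingR-shift (x + natR q) (p ℕ.+ q) ⟨
      fallingR (1# + (x + natR q)) (suc (p ℕ.+ q))
        ≈⟨ fallingR-cong (suc (p ℕ.+ q)) (solve 2 (λ x q → con (+ 1) :+ (x :+ q) := x :+ (con (+ 1) :+ q)) refl x (natR q)) ⟩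
      fallingR (x + natR (suc q)) (suc (p ℕ.+ q))
        ≡⟨ ≡.cong (fallingR (x + natR (suc q))) (ℕₚ.+-suc p q) ⟨
      fallingR (x + natR (suc q)) (p ℕ.+ suc q) ∎

  eval-Uinv-monomial : ∀ {n p} → p ≤ n → ∀ x → eval (Uinv n (monomial p)) x ≈ fallingR (x + natR (n ∸ p)) n
  eval-Uinv-monomial {n} {p} p≤n x = begin
    eval (Uinv n (monomial p)) x                    ≈⟨ eval-linExtFrom-monomial (UinvBasis n) 0 p x ⟩
    eval (fallingP p ⊗ risingP1 (n ∸ p)) x          ≈⟨ eval-fallingP⊗risingP1 p (n ∸ p) x ⟩
    fallingR (x + natR (n ∸ p)) (p ℕ.+ (n ∸ p))     ≡⟨ ≡.cong (fallingR (x + natR (n ∸ p))) (m+[n∸m]≡n p≤n) ⟩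
    fallingR (x + natR (n ∸ p)) n                   ∎

  eval-shifted-Uinv-monomial : ∀ {n p} → p ≤ n → ∀ γ x →
    eval (E γ (Uinv n (monomial p))) x ≈ fallingR ((γ + natR (n ∸ p)) + x) n
  eval-shifted-Uinv-monomial {n} {p} p≤n γ x = begin
    eval (E γ (Uinv n (monomial p))) x        ≈⟨ eval-E γ (Uinv n (monomial p)) x ⟩
    eval (Uinv n (monomial p)) (x + γ)        ≈⟨ eval-Uinv-monomial p≤n (x + γ) ⟩
    fallingR ((x + γ) + natR (n ∸ p)) n
      ≈⟨ fallingR-cong n (solve 3 (λ x g m → (x :+ g) :+ m := (g :+ m) :+ x) refl x γ (natR (n ∸ p))) ⟩
    fallingR ((γ + natR (n ∸ p)) + x) n       ∎

  -- Coefficients of `U`.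

  coeff-map-applyUpTo : ∀ f (g : ℕ → ℕ) {n k} → k < n → coeff (map f (applyUpTo g n)) k ≡ f (g k)
  coeff-map-applyUpTo f g {suc n} {zero}  k<n       = ≡.refl
  coeff-map-applyUpTo f g {suc n} {suc k} (s≤s k<n) = coeff-map-applyUpTo f (g ∘ suc) k<n

  coeff-map-applyUpTo-≥ : ∀ f (g : ℕ → ℕ) {n k} → n ≤ k → coeff (map f (applyUpTo g n)) k ≡ 0#
  coeff-map-applyUpTo-≥ f g {zero}  {k}     n≤k       = ≡.refl
  coeff-map-applyUpTo-≥ f g {suc n} {suc k} (s≤s n≤k) = coeff-map-applyUpTo-≥ f (g ∘ suc) n≤k

  coeff-linExtFrom-∷ : ∀ f m a c k →
    coeff (linExtFrom f m (a ∷ c)) k ≈ a * coeff (f m) k + coeff (linExtFrom f (suc m) c) k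
  coeff-linExtFrom-∷ f m a c k =
    trans (coeff-⊕ (scale a (f m)) (linExtFrom f (suc m) c) k) (+-congʳ (coeff-scale a (f m) k))

  -- A list `c` read from index m stands for x^m c(x), and keeping m general permits induction on
  -- `c`. The bound k ≤ n is the range of coefficients that `UBasis` lists.
  coeff-linExtFrom-UBasis : ∀ {n k} → k ≤ n → ∀ m c →
    coeff (linExtFrom (UBasis n) m c) k
      ≈ invFact n * conv (coeff (oneMinusXPow (suc n))) (λ j → pow (natR j) m * eval c (natR j)) k
  coeff-linExtFrom-UBasis {n} {k} k≤n m [] = sym (begin
    invFact n * conv w (λ j → pow (natR j) m * 0#) k
      -- Writing 0 as -1 · 0 + 0 lets linearity express the product with the zero sequence as -z +
      -- z.
      ≈⟨ *-congˡ (conv-congʳ w k λ j → solve 1 (λ x → x :* con (+ 0) := :- con (+ 1) :* con (+ 0) :+ con (+ 0)) refl (pow (natR j) m)) ⟩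
    invFact n * conv w (λ j → - 1# * 0# + 0#) k
      ≈⟨ *-congˡ (conv-linearʳ (- 1#) w (λ _ → 0#) (λ _ → 0#) k) ⟩
    invFact n * (- 1# * conv w (λ _ → 0#) k + conv w (λ _ → 0#) k)
      ≈⟨ solve 2 (λ x y → x :* (:- con (+ 1) :* y :+ y) := con (+ 0)) refl (invFact n) (conv w (λ _ → 0#) k) ⟩
    0# ∎)
    where
    w : ℕ → Carrier
    w = coeff (oneMinusXPow (suc n))
  coeff-linExtFrom-UBasis {n} {k} k≤n m (a ∷ c) = begin
    coeff (linExtFrom (UBasis n) m (a ∷ c)) k
      ≈⟨ coeff-linExtFrom-∷ (UBasis n) m a c k ⟩
    a * coeff (UBasis n m) k + coeff (linExtFrom (UBasis n) (suc m) c) k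
      ≈⟨ +-cong (*-congˡ (trans (reflexive (coeff-map-applyUpTo (λ i → invFact n * seriesCoeff n m i) id (s≤s k≤n))) (*-congˡ (seriesCoeff≈conv n m k))))
                (coeff-linExtFrom-UBasis k≤n (suc m) c) ⟩
    a * (invFact n * conv w (λ j → pow (natR j) m) k) + invFact n * conv w h k
      ≈⟨ solve 4 (λ a i x y → a :* (i :* x) :+ i :* y := i :* (a :* x :+ y)) refl a (invFact n) _ _ ⟩
    invFact n * (a * conv w (λ j → pow (natR j) m) k + conv w h k)
      ≈⟨ *-congˡ (conv-linearʳ a w (λ j → pow (natR j) m) h k) ⟨
    invFact n * conv w (λ j → a * pow (natR j) m + h j) k
      ≈⟨ *-congˡ (conv-congʳ w k λ j → solve 4 (λ a x y z → a :* x :+ (x :* y) :* z := x :* (a :+ y :* z))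
                                             refl a (pow (natR j) m) (natR j) (eval c (natR j))) ⟩
    invFact n * conv w (λ j → pow (natR j) m * eval (a ∷ c) (natR j)) k ∎
    where
    w h : ℕ → Carrier
    w = coeff (oneMinusXPow (suc n))
    h j = pow (natR j) (suc m) * eval c (natR j)

  coeff-U : ∀ {n k} → k ≤ n → ∀ c → coeff (U n c) k ≈ invFact n * ∇^ (suc n) (λ j → eval c (natR j)) k
  coeff-U {n} {k} k≤n c = trans (coeff-linExtFrom-UBasis k≤n 0 c) (*-congˡ (trans
    (conv-congʳ (coeff (oneMinusXPow (suc n))) k (λ j → *-identityˡ _))
    (conv-oneMinusXPow (suc n) (λ j → eval c (natR j)) k)))

  coeff-linExtFrom-UBasis-> : ∀ {n k} → n < k → ∀ m c → coeff (linExtFrom (UBasis n) m c) k ≈ 0#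
  coeff-linExtFrom-UBasis-> n<k m []      = refl
  coeff-linExtFrom-UBasis-> {n} {k} n<k m (a ∷ c) = trans (coeff-linExtFrom-∷ (UBasis n) m a c k) (trans
    (+-cong (trans (*-congˡ (reflexive (coeff-map-applyUpTo-≥ (λ i → invFact n * seriesCoeff n m i) id n<k))) (zeroʳ a))
            (coeff-linExtFrom-UBasis-> n<k (suc m) c))
    (+-identityˡ 0#))

  -- Binomial coefficients.

  -- binom y (n − k), read as 0 when k > n.
  binom-diff : Carrier → ℕ → ℕ → Carrier
  binom-diff y n       zero    = binom y n
  binom-diff y zero    (suc k) = 0#
  binom-diff y (suc n) (suc k) = binom-diff y n k

  binom-diff-≤ : ∀ y {n k} → k ≤ n → binom-diff y n k ≡ binom y (n ∸ k)
  binom-diff-≤ y z≤n       = ≡.refl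
  binom-diff-≤ y (s≤s k≤n) = binom-diff-≤ y k≤n

  binom-cong : ∀ {x y} k → x ≈ y → binom x k ≈ binom y k
  binom-cong k x≈y = *-congʳ (fallingR-cong k x≈y)

  module _ (natR-inverse : ∀ i → natR (suc i) * inv (natR (suc i)) ≈ 1#) where

    invFact-suc : ∀ k → natR (suc k) * invFact (suc k) ≈ invFact k
    invFact-suc k = begin
      natR (suc k) * (invFact k * inv (natR (suc k)))
        ≈⟨ solve 3 (λ x y z → x :* (y :* z) := y :* (x :* z)) refl (natR (suc k)) (invFact k) (inv (natR (suc k))) ⟩
      invFact k * (natR (suc k) * inv (natR (suc k)))
        ≈⟨ trans (*-congˡ (natR-inverse k)) (*-identityʳ _) ⟩
      invFact k ∎

    binom-suc : ∀ x k → natR (suc k) * binom x (suc k) ≈ (x - natR k) * binom x k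
    binom-suc x k = begin
      natR (suc k) * ((fallingR x k * (x - natR k)) * invFact (suc k))
        ≈⟨ solve 4 (λ n f y i → n :* ((f :* y) :* i) := (n :* i) :* (f :* y))
                 refl (natR (suc k)) (fallingR x k) (x - natR k) (invFact (suc k)) ⟩
      (natR (suc k) * invFact (suc k)) * (fallingR x k * (x - natR k))
        ≈⟨ *-congʳ (invFact-suc k) ⟩
      invFact k * (fallingR x k * (x - natR k))
        ≈⟨ solve 3 (λ i f y → i :* (f :* y) := y :* (f :* i)) refl (invFact k) (fallingR x k) (x - natR k) ⟩
      (x - natR k) * (fallingR x k * invFact k) ∎

    -- The front factor 1 + x splits as (x - k) + (k + 1): the first part extends the falling
    -- factorial, the second cancels against 1/(k+1)!.
    binom-Pascal : ∀ x k → binom (1# + x) (suc k) ≈ binom x (suc k) + binom x k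
    binom-Pascal x k = begin
      fallingR (1# + x) (suc k) * i
        ≈⟨ *-congʳ (fallingR-shift x k) ⟩
      ((1# + x) * f) * i
        ≈⟨ solve 4 (λ x f i k → ((con (+ 1) :+ x) :* f) :* i := (f :* (x :- k)) :* i :+ f :* ((con (+ 1) :+ k) :* i))
                 refl x f i (natR k) ⟩
      (f * (x - natR k)) * i + f * (natR (suc k) * i)
        ≈⟨ +-congˡ (*-congˡ (invFact-suc k)) ⟩
      (f * (x - natR k)) * i + f * invFact k ∎
      where
      f i : Carrier
      f = fallingR x k
      i = invFact (suc k)

    -- For k ≤ n this is `binom-suc` at index n - k. Keeping `natR k` as a separate term avoids
    -- truncated subtraction and gives an identity for every k.
    binom-diff-suc : ∀ y n k →
      (y - natR n + natR k) * binom-diff y n k ≈ (natR (suc n) - natR k) * binom-diff y (suc n) k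
    binom-diff-suc y n zero = begin
      (y - natR n + 0#) * binom y n                 ≈⟨ *-congʳ (+-identityʳ _) ⟩
      (y - natR n) * binom y n                      ≈⟨ binom-suc y n ⟨
      natR (suc n) * binom y (suc n)                ≈⟨ solve 2 (λ n b → n :* b := (n :- con (+ 0)) :* b) refl _ _ ⟩
      (natR (suc n) - 0#) * binom y (suc n)         ∎
    -- On the boundary k = n + 1 the left side vanishes through `binom-diff`, the right side through
    -- its coefficient 1 - 1.
    binom-diff-suc y zero (suc zero)    =
      solve 2 (λ y b → (y :- con (+ 0) :+ (con (+ 1) :+ con (+ 0))) :* con (+ 0)
                  := ((con (+ 1) :+ con (+ 0)) :- (con (+ 1) :+ con (+ 0))) :* b) refl y (binom y 0)
    binom-diff-suc y zero (suc (suc k)) = trans (zeroʳ _) (sym (zeroʳ _))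
    binom-diff-suc y (suc n) (suc k) = begin
      (y - (1# + natR n) + (1# + natR k)) * binom-diff y n k
        ≈⟨ *-congʳ (solve 3 (λ y n k → y :- (con (+ 1) :+ n) :+ (con (+ 1) :+ k) := y :- n :+ k) refl y (natR n) (natR k)) ⟩
      (y - natR n + natR k) * binom-diff y n k
        ≈⟨ binom-diff-suc y n k ⟩
      (natR (suc n) - natR k) * binom-diff y (suc n) k
        ≈⟨ *-congʳ (solve 2 (λ n k → n :- k := (con (+ 1) :+ n) :- (con (+ 1) :+ k)) refl (natR (suc n)) (natR k)) ⟩
      (natR (suc (suc n)) - natR (suc k)) * binom-diff y (suc n) k ∎

    -- The recurrence shared by differences and products.

    module _ (y : Carrier) where

      differences : ℕ → ℕ → Carrier
      differences n = ∇^ (suc n) (λ j → fallingR (y + natR j) n)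

      product : ℕ → ℕ → Carrier
      product n k = binom (natR n - y) k * binom-diff y n k

      -- On generating series this is S ↦ (y - n + θ)((1-x)S) + (n+2)xS with θ = x d/dx. For S =
      -- (1-x)^(n+1) F the Leibniz rule turns it into (1-x)^(n+2) (y - n + θ)F.
      recurrence : ℕ → (ℕ → Carrier) → ℕ → Carrier
      recurrence n s k = (y - natR n + natR k) * ∇ s k + natR (suc (suc n)) * shift s k

      recurrence-cong : ∀ n {s t} → (∀ k → s k ≈ t k) → ∀ k → recurrence n s k ≈ recurrence n t k
      recurrence-cong n s≈t zero    = +-congʳ (*-congˡ (∇-cong s≈t 0))
      recurrence-cong n s≈t (suc k) = +-cong (*-congˡ (∇-cong s≈t (suc k))) (*-congˡ (s≈t k))

      recurrence-scale : ∀ n a s k → recurrence n (λ j → a * s j) k ≈ a * recurrence n s k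
      recurrence-scale n a s zero    =
        solve 4 (λ a b c x → b :* (a :* x :- con (+ 0)) :+ c :* con (+ 0) := a :* (b :* (x :- con (+ 0)) :+ c :* con (+ 0)))
                refl a (y - natR n + 0#) (natR (suc (suc n))) (s 0)
      recurrence-scale n a s (suc k) =
        solve 5 (λ a b c x z → b :* (a :* x :- a :* z) :+ c :* (a :* z) := a :* (b :* (x :- z) :+ c :* z))
                refl a (y - natR n + natR (suc k)) (natR (suc (suc n))) (s (suc k)) (s k)

      -- The new factor y + j - n of the falling factorial is the scalar y - n plus multiplication
      -- by j; linearity handles the first and `∇^-natR-*` the second.
      differences-suc : ∀ n k → differences (suc n) k ≈ recurrence n (differences n) k
      differences-suc n k = begin
        ∇^ (suc (suc n)) (λ j → f j * (y + natR j - natR n)) k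
          ≈⟨ ∇^-cong (suc (suc n)) (λ j →
               solve 4 (λ f y j n → f :* (y :+ j :- n) := (y :- n) :* f :+ j :* f) refl (f j) y (natR j) (natR n)) k ⟩
        ∇^ (suc (suc n)) (λ j → (y - natR n) * f j + natR j * f j) k
          ≈⟨ ∇^-linear (suc (suc n)) (y - natR n) f (λ j → natR j * f j) k ⟩
        (y - natR n) * d + ∇^ (suc (suc n)) (λ j → natR j * f j) k
          ≈⟨ +-congˡ (∇^-natR-* (suc n) f k) ⟩
        (y - natR n) * d + (natR k * d + e)
          ≈⟨ solve 4 (λ a d k e → a :* d :+ (k :* d :+ e) := (a :+ k) :* d :+ e) refl (y - natR n) d (natR k) e ⟩
        recurrence n (differences n) k ∎
        where
        f : ℕ → Carrier
        f j = fallingR (y + natR j) n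
        d e : Carrier
        d = ∇^ (suc (suc n)) f k
        e = natR (suc (suc n)) * shift (∇^ (suc n) f) k

      -- Absorption in each binomial brings all terms to a common second factor, and Pascal's rule
      -- merges the first factors.
      product-suc : ∀ n k → recurrence n (product n) k ≈ natR (suc n) * product (suc n) k
      product-suc n zero = begin
        (y - natR n + 0#) * (binom (natR n - y) 0 * binom y n - 0#) + natR (suc (suc n)) * 0#
          ≈⟨ solve 4 (λ a b d c → a :* (b :* d :- con (+ 0)) :+ c :* con (+ 0) := b :* (a :* d))
                   refl (y - natR n + 0#) (binom (natR n - y) 0) (binom y n) (natR (suc (suc n))) ⟩
        binom (natR n - y) 0 * ((y - natR n + 0#) * binom y n)
          ≈⟨ *-congˡ (binom-diff-suc y n 0) ⟩
        binom (natR n - y) 0 * ((natR (suc n) - 0#) * binom y (suc n))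
          ≈⟨ solve 3 (λ b c d → b :* ((c :- con (+ 0)) :* d) := c :* (b :* d))
                   refl (binom (natR n - y) 0) (natR (suc n)) (binom y (suc n)) ⟩
        natR (suc n) * (binom (natR n - y) 0 * binom y (suc n)) ∎
      product-suc n (suc k) = begin
        (y - natR n + natR (suc k)) * (b₊ * d₋ - b * d) + natR (suc (suc n)) * (b * d)
          -- The coefficient -(y - n + k + 1) + (n + 2) of b d is regrouped as (n - y - k) + (n +
          -- 1), so that `binom-suc` applies to the first part.
          ≈⟨ solve 7 (λ y n k b₊ d₋ b d →
                 (y :- n :+ (con (+ 1) :+ k)) :* (b₊ :* d₋ :- b :* d) :+ (con (+ 1) :+ (con (+ 1) :+ n)) :* (b :* d)
                   := b₊ :* ((y :- n :+ (con (+ 1) :+ k)) :* d₋)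
                        :+ (((n :- y) :- k) :* b :+ (con (+ 1) :+ n) :* b) :* d)
               refl y (natR n) (natR k) b₊ d₋ b d ⟩
        b₊ * ((y - natR n + natR (suc k)) * d₋) + ((natR n - y - natR k) * b + natR (suc n) * b) * d
          ≈⟨ +-cong (*-congˡ (binom-diff-suc y n (suc k))) (*-congʳ (+-congʳ (sym (binom-suc (natR n - y) k)))) ⟩
        b₊ * ((natR (suc n) - natR (suc k)) * d) + (natR (suc k) * b₊ + natR (suc n) * b) * d
          -- `binom-diff y (suc n) (suc k)` is `d` by definition, so `d` is a common factor; the two
          -- multiples of b₊ by k + 1 cancel.
          ≈⟨ solve 5 (λ n k b₊ b d → b₊ :* ((n :- k) :* d) :+ (k :* b₊ :+ n :* b) :* d := n :* ((b₊ :+ b) :* d))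
                   refl (natR (suc n)) (natR (suc k)) b₊ b d ⟩
        natR (suc n) * ((b₊ + b) * d)
          ≈⟨ *-congˡ (*-congʳ (binom-Pascal (natR n - y) k)) ⟨
        natR (suc n) * (binom (1# + (natR n - y)) (suc k) * d)
          ≈⟨ *-congˡ (*-congʳ (binom-cong (suc k) (+-assoc 1# (natR n) (- y)))) ⟨
        natR (suc n) * product (suc n) (suc k) ∎
        where
        b b₊ d d₋ : Carrier
        b  = binom (natR n - y) k
        b₊ = binom (natR n - y) (suc k)
        d  = binom-diff y n k
        d₋ = binom-diff y n (suc k)

      -- Induction on n along the common recurrence: the factor n + 1 produced by `product-suc`
      -- cancels against the new inverse in `invFact (suc n)`.
      invFact-*-differences : ∀ n k → invFact n * differences n k ≈ product n k
      -- For n = 0 the sequence is constantly 1, whose first difference is 1 at index 0 and 0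
      -- afterwards.
      invFact-*-differences zero zero    =
        solve 0 (con (+ 1) :* (con (+ 1) :- con (+ 0)) := (con (+ 1) :* con (+ 1)) :* (con (+ 1) :* con (+ 1))) refl
      invFact-*-differences zero (suc k) =
        solve 1 (λ b → con (+ 1) :* (con (+ 1) :- con (+ 1)) := b :* con (+ 0)) refl (binom (0# - y) (suc k))
      invFact-*-differences (suc n) k = begin
        (invFact n * i) * differences (suc n) k
          ≈⟨ *-congˡ (differences-suc n k) ⟩
        (invFact n * i) * recurrence n (differences n) k
          ≈⟨ solve 3 (λ a i x → (a :* i) :* x := i :* (a :* x)) refl (invFact n) i (recurrence n (differences n) k) ⟩
        i * (invFact n * recurrence n (differences n) k)
          ≈⟨ *-congˡ (recurrence-scale n (invFact n) (differences n) k) ⟨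
        i * recurrence n (λ j → invFact n * differences n j) k
          ≈⟨ *-congˡ (recurrence-cong n (invFact-*-differences n) k) ⟩
        i * recurrence n (product n) k
          ≈⟨ *-congˡ (product-suc n k) ⟩
        i * (natR (suc n) * product (suc n) k)
          ≈⟨ solve 3 (λ i n x → i :* (n :* x) := (n :* i) :* x) refl i (natR (suc n)) (product (suc n) k) ⟩
        (natR (suc n) * i) * product (suc n) k
          ≈⟨ trans (*-congʳ (natR-inverse n)) (*-identityˡ _) ⟩
        product (suc n) k ∎
        where
        i : Carrier
        i = inv (natR (suc n))

    -- Coefficients of `G` on monomials.

    coeff-G-monomial-≤ : ∀ {n p k} → p ≤ n → k ≤ n → ∀ β →
      coeff (G n β (monomial p)) k ≈ coeff (rhs n β p) k
    coeff-G-monomial-≤ {n} {p} {k} p≤n k≤n β = begin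
      coeff (U n (E γ (Uinv n (monomial p)))) k
        ≈⟨ coeff-U k≤n (E γ (Uinv n (monomial p))) ⟩
      invFact n * ∇^ (suc n) (λ j → eval (E γ (Uinv n (monomial p))) (natR j)) k
        ≈⟨ *-congˡ (∇^-cong (suc n) (λ j → eval-shifted-Uinv-monomial p≤n γ (natR j)) k) ⟩
      invFact n * differences y n k
        ≈⟨ invFact-*-differences y n k ⟩
      binom (natR n - y) k * binom-diff y n k
        ≈⟨ *-cong (binom-cong k n-y) (reflexive (binom-diff-≤ y k≤n)) ⟩
      binom (- γ + natR p) k * binom y (n ∸ k)
        ≡⟨ coeff-map-applyUpTo (λ m → binom (- γ + natR p) m * binom y (n ∸ m)) id (s≤s k≤n) ⟨
      coeff (rhs n β p) k ∎
      where
      γ y : Carrier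
      γ = natR n * β
      y = γ + natR (n ∸ p)

      -- Writing n as p + (n - p) cancels the summand n - p of `y`.
      n-y : natR n - y ≈ - γ + natR p
      n-y = begin
        natR n - y                                        ≡⟨ ≡.cong (λ m → natR m - y) (m+[n∸m]≡n p≤n) ⟨
        natR (p ℕ.+ (n ∸ p)) - y                          ≈⟨ +-congʳ (natR-+ p (n ∸ p)) ⟩
        (natR p + natR (n ∸ p)) - (γ + natR (n ∸ p))
          ≈⟨ solve 3 (λ p m g → (p :+ m) :- (g :+ m) := :- g :+ p) refl (natR p) (natR (n ∸ p)) γ ⟩
        - γ + natR p                                      ∎

    coeff-G-monomial : ∀ {n p} → p ≤ n → ∀ β k → coeff (G n β (monomial p)) k ≈ coeff (rhs n β p) k
    coeff-G-monomial {n} {p} p≤n β k with k ≤? n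
    ... | yes k≤n = coeff-G-monomial-≤ p≤n k≤n β
    -- Beyond degree n both lists have run out of nonzero entries: each `UBasis n m` and `rhs` list
    -- only degrees 0 to n.
    ... | no  k≰n = trans
      (coeff-linExtFrom-UBasis-> (≰⇒> k≰n) 0 (E (natR n * β) (Uinv n (monomial p))))
      (reflexive (≡.sym (coeff-map-applyUpTo-≥
        (λ m → binom (- (natR n * β) + natR p) m * binom (natR n * β + natR (n ∸ p)) (n ∸ m)) id (≰⇒> k≰n))))

theorem6p3 : {c ℓ : Level} (R : CommutativeRing c ℓ)
    (inv : CommutativeRing.Carrier R → CommutativeRing.Carrier R) →
    (let open CommutativeRing R in
    ∀ (i : ℕ) → Poly.natR R inv (suc i) * inv (Poly.natR R inv (suc i)) ≈ 1#) →
    (n : ℕ) (β : CommutativeRing.Carrier R) (p : ℕ) → p ≤ n →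
    (k : ℕ) →
    CommutativeRing._≈_ R
    (Poly.coeff R inv (Poly.G R inv n β (Poly.monomial R inv p)) k)
    (Poly.coeff R inv (Poly.rhs R inv n β p) k)
theorem6p3 R inv natR-inverse n β p p≤n k = Differences.coeff-G-monomial R inv natR-inverse p≤n β k
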